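{- Let $k\in\{2,3\}$. In the query model: (i) there exists a randomized algorithm that, given any tournament on $n$ vertices, solves the $k$-king problem (i.e. outputs a set of $k$ distinct kings, or $\bot$ if the tournament has fewer than $k$ kings) using $O(n)$ queries; and (ii) there exists a deterministic algorithm that, given any tournament on $n$ vertices, solves the $k$-king problem using $O(n^{3/2})$ queries.
   Context: A tournament is a directed graph such that for every two distinct vertices $u,v$ exactly one of the edges $u\to v$, $v\to u$ is present. A vertex $v$ of a tournament is a king if for every other vertex $u$ there is a directed path from $v$ to $u$ of length (number of edges) at most $2$. The $k$-king problem: given a tournament, output a set of any $k$ distinct kings of it, or $\bot$ if the tournament does not contain $k$ kings. Query model: the vertex set is known to the algorithm; each query specifies a pair of distinct vertices $u,v$, and the oracle answers whether $u\to v$ or $v\to u$. The cost ("time") is the number of queries. For deterministic algorithms the bound holds on every input. For randomized algorithms the algorithm is zero-error (always outputs a correct answer) and the bound is on the expected number of queries over its internal randomness, for every input. -}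

module Defs where

open import Algebra.Properties.CommutativeMonoid.Sum using (sum)
open import Data.Bool using (Bool; true; false; not)
open import Data.Fin using (Fin)
open import Data.Fin.Subset using (Subset; _∈_; ∣_∣)
open import Data.Integer using (+_)
open import Data.Maybe using (Maybe; just; nothing)
open import Data.Nat as ℕ using (ℕ; suc; NonZero)
open import Data.Product using (Σ-syntax; ∃; ∃-syntax; _×_)
open import Data.Rational as ℚ using (ℚ; 0ℚ; 1ℚ; _/_)
open import Data.Rational.Properties using (+-0-commutativeMonoid)
open import Data.Sum using (_⊎_)
open import Relation.Binary.PropositionalEquality using (_≡_; _≢_)
open import Relation.Nullary using (¬_)

record Tournament (n : ℕ) : Set where
  field
    edge        : Fin n → Fin n → Bool
    loopless    : ∀ v → edge v v ≡ false
    exactly-one : ∀ {u v} → u ≢ v → edge u v ≡ not (edge v u)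

  infix 4 _⟶_
  _⟶_ : Fin n → Fin n → Set
  u ⟶ v = edge u v ≡ true

open Tournament public using (edge)

module _ {n : ℕ} (T : Tournament n) where
  open Tournament T using (_⟶_)

  IsKing : Fin n → Set
  IsKing v = ∀ u → u ≢ v → (v ⟶ u) ⊎ (∃[ w ] (v ⟶ w) × (w ⟶ u))

  IsKingSet : ℕ → Subset n → Set
  IsKingSet k S = ∣ S ∣ ≡ k × (∀ {v} → v ∈ S → IsKing v)

  -- The output ⊥ of the k-king problem is encoded as `nothing`.
  SolvesKKing : ℕ → Maybe (Subset n) → Set
  SolvesKKing k (just S) = IsKingSet k S
  SolvesKKing k nothing  = ¬ ∃ (IsKingSet k)

-- Deterministic decision trees.  The answer to the query {u, v} is `true` when
-- u → v and `false` when v → u.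
data DetAlg (n : ℕ) (A : Set) : Set where
  output : A → DetAlg n A
  query  : (u v : Fin n) → u ≢ v → (Bool → DetAlg n A) → DetAlg n A

module _ {n : ℕ} {A : Set} (T : Tournament n) where

  run : DetAlg n A → A
  run (output x)      = x
  run (query u v _ f) = run (f (edge T u v))

  queries : DetAlg n A → ℕ
  queries (output x)      = 0
  queries (query u v _ f) = suc (queries (f (edge T u v)))

-- Randomized decision trees.  `random m f` draws i uniformly from Fin m, with
-- fresh independent randomness at each such node, and continues with f i.
-- Drawing is free: only queries are charged.
data RandAlg (n : ℕ) (A : Set) : Set where
  output : A → RandAlg n A
  query  : (u v : Fin n) → u ≢ v → (Bool → RandAlg n A) → RandAlg n A
  random : (m : ℕ) .{{_ : NonZero m}} → (Fin m → RandAlg n A) → RandAlg n A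

module _ {n : ℕ} {A : Set} (T : Tournament n) where

  -- The output satisfies P whatever the outcomes of the random draws.
  Always : (A → Set) → RandAlg n A → Set
  Always P (output x)      = P x
  Always P (query u v _ f) = Always P (f (edge T u v))
  Always P (random m f)    = ∀ i → Always P (f i)

  expectedQueries : RandAlg n A → ℚ
  expectedQueries (output x)      = 0ℚ
  expectedQueries (query u v _ f) = 1ℚ ℚ.+ expectedQueries (f (edge T u v))
  expectedQueries (random m f)    =
    (+ 1 / m) ℚ.* sum +-0-commutativeMonoid (λ i → expectedQueries (f i))

-- q ≤ C n^(3/2), squared to stay within ℕ.
_≤_·_^3/2 : ℕ → ℕ → ℕ → Set
q ≤ C · n ^3/2 = q ℕ.^ 2 ℕ.≤ C ℕ.^ 2 ℕ.* n ℕ.^ 3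

-- Algorithms are non-uniform: one decision tree for each number n of vertices.
KKingRandomizedLinear : ℕ → Set
KKingRandomizedLinear k =
  Σ[ alg ∈ (∀ n → RandAlg n (Maybe (Subset n))) ] ∃[ C ]
    (∀ n (T : Tournament n) →
      Always T (SolvesKKing T k) (alg n) ×
      expectedQueries T (alg n) ℚ.≤ + (C ℕ.* n) / 1)

KKingDeterministicThreeHalves : ℕ → Set
KKingDeterministicThreeHalves k =
  Σ[ alg ∈ (∀ n → DetAlg n (Maybe (Subset n))) ] ∃[ C ]
    (∀ n (T : Tournament n) →
      SolvesKKing T k (run T (alg n)) ×
      queries T (alg n) ≤ C · n ^3/2)

{-# OPTIONS --safe #-}
module Submission where

open import Defs
open import Data.Bool as Bool using (Bool; true; false; if_then_else_; not)
open import Data.Bool.Properties using (not-¬)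
open import Data.Fin as Fin using (Fin; zero; suc)
open import Data.Fin.Subset using (Subset; ∣_∣; ⁅_⁆; _∪_; _∉_)
  renaming (_∈_ to _∈ₛ_)
open import Data.Fin.Subset.Properties
  using (∣⁅x⁆∣≡1; p⊆q⇒∣p∣≤∣q∣; x∈⁅x⁆; x∈⁅y⁆⇒x≡y; x∈p∪q⁻; ∪-identityˡ)
open import Data.Integer as ℤ using (+_)
import Data.Integer.Properties as ℤ
open import Data.List using (List; []; _∷_; length; map; filter; take; lookup; allFin; tabulate)
open import Data.List.Membership.Propositional using (_∈_)
open import Data.List.Membership.Propositional.Properties
  using (∈-filter⁺; ∈-filter⁻; ∈-allFin; ∈-lookup)
open import Data.List.Properties using (length-tabulate; length-filter; filter-notAll; filter-reject; length-take)
open import Data.List.Relation.Unary.All as All using (All; []; _∷_)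
import Data.List.Relation.Unary.All.Properties as All using (take⁺)
open import Data.List.Relation.Unary.All.Properties using (¬Any⇒All¬)
open import Data.List.Relation.Unary.Any as Any using (Any; here; there; any?)
open import Data.Maybe using (Maybe; just; nothing)
open import Data.Nat hiding (compare; _/_)
open import Data.Nat.ListAction using (sum)
open import Data.Nat.Properties
open import Data.Nat.Tactic.RingSolver using (solve-∀)
open import Data.Product using (∃-syntax; _×_; _,_; proj₁; proj₂)
open import Data.Rational as ℚ using (ℚ; 1ℚ; _/_)
import Data.Rational.Properties as ℚ
import Data.Rational.Unnormalised as ℚᵘ
import Data.Rational.Unnormalised.Properties as ℚᵘ
open import Data.Sum using (_⊎_; inj₁; inj₂)
open import Data.Vec using ([]; _∷_; here; there)
open import Function using (_∘_)
open import Relation.Binary.PropositionalEquality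
  using (_≡_; _≢_; refl; sym; trans; cong; cong₂; subst; subst₂)
open import Relation.Nullary using (Dec; does; ¬_; yes; no; contradiction)

-- A king of the subtournament on the in-neighbours of v is a king of the whole
-- tournament, so one finds a king by repeatedly choosing a pivot v and passing to
-- its in-neighbours, until there are none and v itself is a king.  A uniformly
-- random pivot halves the vertex set on average, which gives O(n) expected queries.
-- Deterministically, a pivot with small in-degree in a sample of about √n vertices
-- costs O(n) queries and discards about √n / 2 vertices, which gives O(n^(3/2)).
--
-- For several kings, take a king v₁, a king v₂ of its in-neighbours and a king v₃
-- of the in-neighbours of v₂.  If v₁ has no in-neighbours it is the only king;
-- otherwise v₂ has one, since otherwise v₂ would be the only king.  They are
-- distinct because v₃ → v₂ → v₁.

private variable
  n c d : ℕ

-- In-neighbours and in-degrees in a tournament.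

module _ {n : ℕ} (T : Tournament n) where
  open Tournament T using (_⟶_; loopless; exactly-one)

  _⟶?_ : ∀ u v → Dec (u ⟶ v)
  u ⟶? v = edge T u v Bool.≟ true

  inNeighbours : Fin n → List (Fin n) → List (Fin n)
  inNeighbours v = filter (_⟶? v)

  ⟶-irrefl : ∀ {v} → ¬ v ⟶ v
  ⟶-irrefl {v} v⟶v = contradiction (trans (sym v⟶v) (loopless v)) λ ()

  ⟶-asym : ∀ {u v} → u ⟶ v → ¬ v ⟶ u
  ⟶-asym {u} {v} u⟶v v⟶u with u Fin.≟ v
  ... | yes refl = ⟶-irrefl u⟶v
  ... | no u≢v   = not-¬ (trans u⟶v (sym v⟶u)) (exactly-one u≢v)

  ⟶-total : ∀ {u v} → u ≢ v → ¬ u ⟶ v → v ⟶ u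
  ⟶-total {u} {v} u≢v u↛v with edge T v u in eq
  ... | true  = refl
  ... | false = contradiction (trans (exactly-one u≢v) (cong not eq)) u↛v

  inNeighbours-< : ∀ {v R} → v ∈ R → length (inNeighbours v R) < length R
  inNeighbours-< v∈R = filter-notAll _ _ (Any.map (λ { refl → ⟶-irrefl }) v∈R)

  inDegrees : List (Fin n) → List (Fin n) → ℕ
  inDegrees S R = sum (map (λ v → length (inNeighbours v S)) R)

  private
    𝟙 : Bool → ℕ
    𝟙 b = if b then 1 else 0

  length-inNeighbours-∷ : ∀ v x R →
    length (inNeighbours v (x ∷ R)) ≡ 𝟙 (edge T x v) + length (inNeighbours v R)
  length-inNeighbours-∷ v x R with edge T x v
  ... | true  = refl
  ... | false = refl

  𝟙-edges≤1 : ∀ x y → 𝟙 (edge T x y) + 𝟙 (edge T y x) ≤ 1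
  𝟙-edges≤1 x y with edge T x y in xy | edge T y x in yx
  ... | true  | true  = contradiction yx (⟶-asym xy)
  ... | true  | false = ≤-refl
  ... | false | true  = ≤-refl
  ... | false | false = z≤n

  -- Each `y` in `Q` is joined to `x` by at most one edge, so it is charged at most once: as an
  -- in-neighbour of `x`, or for having `x` as an extra in-neighbour.
  inDegrees-∷ : ∀ x R Q →
    length (inNeighbours x Q) + inDegrees (x ∷ R) Q ≤ length Q + inDegrees R Q
  inDegrees-∷ x R []      = z≤n
  inDegrees-∷ x R (y ∷ Q) = begin
    length (inNeighbours x (y ∷ Q)) + (length (inNeighbours y (x ∷ R)) + inDegrees (x ∷ R) Q)
      ≡⟨ cong₂ (λ a b → a + (b + inDegrees (x ∷ R) Q))
           (length-inNeighbours-∷ x y Q) (length-inNeighbours-∷ y x R) ⟩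
    (𝟙 (edge T y x) + length (inNeighbours x Q))
      + ((𝟙 (edge T x y) + length (inNeighbours y R)) + inDegrees (x ∷ R) Q)
      ≡⟨ regroup (𝟙 (edge T y x)) (length (inNeighbours x Q)) (𝟙 (edge T x y))
           (length (inNeighbours y R)) (inDegrees (x ∷ R) Q) ⟩
    (𝟙 (edge T y x) + 𝟙 (edge T x y))
      + (length (inNeighbours x Q) + inDegrees (x ∷ R) Q) + length (inNeighbours y R)
      ≤⟨ +-monoˡ-≤ _ (+-mono-≤ (𝟙-edges≤1 y x) (inDegrees-∷ x R Q)) ⟩
    1 + (length Q + inDegrees R Q) + length (inNeighbours y R)
      ≡⟨ regroup′ (length Q) (inDegrees R Q) (length (inNeighbours y R)) ⟩
    suc (length Q) + (length (inNeighbours y R) + inDegrees R Q) ∎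
    where
    open ≤-Reasoning
    regroup : ∀ a b c d e → (a + b) + ((c + d) + e) ≡ (a + c) + (b + e) + d
    regroup = solve-∀
    regroup′ : ∀ a b c → 1 + (a + b) + c ≡ suc a + (c + b)
    regroup′ = solve-∀

  -- Summing in-degrees counts edges, and each pair of positions in `R` carries at most one.
  -- Repetitions in `R` do no harm, because there are no loops.
  2*inDegrees≤length² : ∀ R → 2 * inDegrees R R ≤ length R * length R
  2*inDegrees≤length² []      = z≤n
  2*inDegrees≤length² (x ∷ R) = begin
    2 * (length (inNeighbours x (x ∷ R)) + inDegrees (x ∷ R) R)
      ≡⟨ cong (λ S → 2 * (length S + inDegrees (x ∷ R) R)) (filter-reject (_⟶? x) ⟶-irrefl) ⟩
    2 * (length (inNeighbours x R) + inDegrees (x ∷ R) R)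
      ≤⟨ *-monoʳ-≤ 2 (inDegrees-∷ x R R) ⟩
    2 * (length R + inDegrees R R)
      ≡⟨ *-distribˡ-+ 2 (length R) _ ⟩
    2 * length R + 2 * inDegrees R R
      ≤⟨ +-monoʳ-≤ (2 * length R) (2*inDegrees≤length² R) ⟩
    2 * length R + length R * length R
      ≤⟨ n≤1+n _ ⟩
    suc (2 * length R + length R * length R)
      ≡⟨ square (length R) ⟩
    suc (length R) * suc (length R) ∎
    where
    open ≤-Reasoning
    square : ∀ m → suc (2 * m + m * m) ≡ suc m * suc m
    square = solve-∀

  Balanced : List (Fin n) → Fin n → Set
  Balanced S v = 2 * length (inNeighbours v S) ≤ length S

  balanced? : ∀ S v → Dec (Balanced S v)
  balanced? S v = 2 * length (inNeighbours v S) ≤? length S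

  -- Averaging: if every vertex had in-degree above half of the length, the in-degrees would sum to
  -- more than the number of edges allows.
  any-balanced : ∀ x R → Any (Balanced (x ∷ R)) (x ∷ R)
  any-balanced x R with any? (balanced? (x ∷ R)) (x ∷ R)
  ... | yes any = any
  ... | no none = contradiction (2*inDegrees≤length² (x ∷ R))
                    (<⇒≱ (many x R (¬Any⇒All¬ (x ∷ R) none)))
    where
    S = x ∷ R
    -- The strict inequality needs at least one summand, hence the mutual recursion with the weak
    -- inequality `rest`, which also covers the empty list.
    many : ∀ y Q → All (¬_ ∘ Balanced S) (y ∷ Q) →
           length (y ∷ Q) * length S < 2 * inDegrees S (y ∷ Q)
    rest : ∀ Q → All (¬_ ∘ Balanced S) Q → length Q * length S ≤ 2 * inDegrees S Q
    many y Q (¬by ∷ ¬bQ) = begin-strict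
      length S + length Q * length S
        <⟨ +-mono-<-≤ (≰⇒> ¬by) (rest Q ¬bQ) ⟩
      2 * length (inNeighbours y S) + 2 * inDegrees S Q
        ≡⟨ *-distribˡ-+ 2 (length (inNeighbours y S)) _ ⟨
      2 * inDegrees S (y ∷ Q) ∎
      where open ≤-Reasoning
    rest []      []  = z≤n
    rest (y ∷ Q) ¬bs = <⇒≤ (many y Q ¬bs)

  -- Kings of a set of vertices.

  Reaches : Fin n → Fin n → Set
  Reaches v u = (v ⟶ u) ⊎ (∃[ w ] (v ⟶ w) × (w ⟶ u))

  -- The intermediate vertex of a path of length 2 may lie outside R.
  KingOf : List (Fin n) → Fin n → Set
  KingOf R v = v ∈ R × (∀ {u} → u ∈ R → u ≢ v → Reaches v u)

  -- `w` beats `v`, and `v` beats every other vertex of `R` outside its in-neighbours, so `w`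
  -- reaches those through `v`.
  king-inNeighbours : ∀ {v w R} → KingOf (inNeighbours v R) w → KingOf R w
  king-inNeighbours {v} {w} {R} (w∈N , reach) = proj₁ (∈-filter⁻ (_⟶? v) w∈N) , reach′
    where
    w⟶v = proj₂ (∈-filter⁻ (_⟶? v) {xs = R} w∈N)
    reach′ : ∀ {u} → u ∈ R → u ≢ w → Reaches w u
    reach′ {u} u∈R u≢w with u Fin.≟ v | u ⟶? v
    ... | yes refl | _        = inj₁ w⟶v
    ... | no _     | yes u⟶v = reach (∈-filter⁺ (_⟶? v) u∈R u⟶v) u≢w
    ... | no u≢v   | no u↛v  = inj₂ (v , w⟶v , ⟶-total u≢v u↛v)

  inNeighbours-[]⁻ : ∀ {v u R} → inNeighbours v R ≡ [] → u ∈ R → ¬ u ⟶ v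
  inNeighbours-[]⁻ {v} {u} none u∈R u⟶v with () ← subst (u ∈_) none (∈-filter⁺ (_⟶? v) u∈R u⟶v)

  source-king : ∀ {v R} → v ∈ R → inNeighbours v R ≡ [] → KingOf R v
  source-king v∈R none =
    v∈R , λ u∈R u≢v → inj₁ (⟶-total u≢v (inNeighbours-[]⁻ none u∈R))

  KingOf-allFin : ∀ {v} → KingOf (allFin n) v → IsKing T v
  KingOf-allFin (_ , reach) u u≢v = reach (∈-allFin u) u≢v

  -- A path from another vertex to `v` would end with an edge into `v`.
  source-unique-king : ∀ {v u} → inNeighbours v (allFin n) ≡ [] → IsKing T u → u ≡ v
  source-unique-king {v} {u} none king with u Fin.≟ v
  ... | yes u≡v = u≡v
  ... | no u≢v with king v (u≢v ∘ sym)
  ...   | inj₁ u⟶v           = contradiction u⟶v (inNeighbours-[]⁻ none (∈-allFin u))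
  ...   | inj₂ (w , _ , w⟶v) = contradiction w⟶v (inNeighbours-[]⁻ none (∈-allFin w))

  source⇒∣kings∣≤1 : ∀ {k v} → inNeighbours v (allFin n) ≡ [] → ∀ S → IsKingSet T k S → k ≤ 1
  source⇒∣kings∣≤1 {v = v} none S (refl , kings) = begin
    ∣ S ∣     ≤⟨ p⊆q⇒∣p∣≤∣q∣ (λ u∈S → subst (_∈ₛ ⁅ v ⁆) (sym (source-unique-king none (kings u∈S))) (x∈⁅x⁆ v)) ⟩
    ∣ ⁅ v ⁆ ∣ ≡⟨ ∣⁅x⁆∣≡1 v ⟩
    1         ∎
    where open ≤-Reasoning

-- Query models and the search for a king.

-- Algorithms are composed in continuation-passing style, so that a model needs
-- no sequencing operation of its own.
record QueryModel (n : ℕ) (A : Set) : Set₁ where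
  field
    Alg     : Set
    answer  : A → Alg
    compare : (u v : Fin n) → u ≢ v → (Bool → Alg) → Alg
    -- Correctness and cost, worst-case or expected depending on the model.
    Meets   : Tournament n → (A → Set) → ℕ → Alg → Set

    meets-answer  : ∀ {T P c x} → P x → Meets T P c (answer x)
    meets-compare : ∀ {T P c u v f} (u≢v : u ≢ v) →
                    Meets T P c (f (edge T u v)) → Meets T P (suc c) (compare u v u≢v f)
    meets-weaken  : ∀ {T P c d a} → c ≤ d → Meets T P c a → Meets T P d a

  -- Only distinct vertices may be compared. For equal ones the value `false` agrees with
  -- looplessness and costs nothing.
  ask : Fin n → Fin n → (Bool → Alg) → Alg
  ask u v k with u Fin.≟ v
  ... | yes _  = k false
  ... | no u≢v = compare u v u≢v k

  meets-ask : ∀ {T P c} u v {k} → Meets T P c (k (edge T u v)) → Meets T P (suc c) (ask u v k)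
  meets-ask {T} {P} u v {k} m with u Fin.≟ v
  ... | no u≢v   = meets-compare u≢v m
  ... | yes refl = meets-weaken (n≤1+n _)
    (subst (λ b → Meets T P _ (k b)) (Tournament.loopless T v) m)

  meets-if : ∀ {T P c a b} {Q : Set} (Q? : Dec Q) → (Q → Meets T P c a) → (¬ Q → Meets T P c b) →
             Meets T P c (if does Q? then a else b)
  meets-if (yes q) f g = f q
  meets-if (no ¬q) f g = g ¬q

  askInNeighbours : Fin n → List (Fin n) → (List (Fin n) → Alg) → Alg
  askInNeighbours v []      k = k []
  askInNeighbours v (u ∷ R) k =
    ask u v λ b → askInNeighbours v R λ S → k (if b then u ∷ S else S)

  meets-askInNeighbours : ∀ {T P c} v R {k} → Meets T P c (k (inNeighbours T v R)) →
                          Meets T P (length R + c) (askInNeighbours v R k)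
  meets-askInNeighbours v [] m = m
  meets-askInNeighbours {T} {P} {c} v (u ∷ R) {k} m =
    meets-ask u v (meets-askInNeighbours v R (subst (λ S → Meets T P c (k S)) unfold m))
    where
    unfold : inNeighbours T v (u ∷ R) ≡
             (if edge T u v then u ∷ inNeighbours T v R else inNeighbours T v R)
    unfold with edge T u v
    ... | true  = refl
    ... | false = refl

record PivotModel (n : ℕ) (A : Set) : Set₁ where
  field
    queryModel : QueryModel n A
  open QueryModel queryModel public
  field
    rate      : ℕ
    withPivot : Fin n → List (Fin n) → (Fin n → Alg) → Alg

    -- Replacing R by the in-neighbours of the pivot v costs length R queries;
    -- if these pay off, the potential rate * length R covers all later rounds.
    meets-withPivot : ∀ {T P c} x xs {k} → let R = x ∷ xs in length R ≤ n →
      (∀ {v} → v ∈ R → Meets T P (length R + (rate * length (inNeighbours T v R) + c)) (k v)) →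
      Meets T P (rate * length R + c) (withPivot x xs k)

  -- The first argument bounds the number of rounds.
  findKing : ℕ → Fin n → List (Fin n) → (Fin n → Alg) → Alg
  descend  : ℕ → Fin n → (Fin n → Alg) → List (Fin n) → Alg

  findKing zero    x xs k = k x
  findKing (suc f) x xs k = withPivot x xs λ v →
    askInNeighbours v (x ∷ xs) (descend f v k)

  descend f v k []       = k v
  descend f v k (y ∷ ys) = findKing f y ys k

  meets-findKing : ∀ {T P c} f x xs {k} → let R = x ∷ xs in length xs ≤ f → length R ≤ n →
    (∀ {v} → KingOf T R v → Meets T P c (k v)) →
    Meets T P (rate * length R + c) (findKing f x xs k)
  -- With no rounds left, `x` is the only vertex and hence trivially a king.
  meets-findKing {T} zero x [] _ _ m =
    meets-weaken (m≤n+m _ _) (m (here refl , λ { (here refl) u≢x → contradiction refl u≢x }))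
  meets-findKing {T} {P} {c} (suc f) x xs {k} ∣xs∣≤f ∣R∣≤n m =
    meets-withPivot x xs ∣R∣≤n λ v∈R → meets-askInNeighbours _ (x ∷ xs) {descend f _ k} (step v∈R)
    where
    step : ∀ {v} → v ∈ x ∷ xs →
           Meets T P (rate * length (inNeighbours T v (x ∷ xs)) + c)
             (descend f v k (inNeighbours T v (x ∷ xs)))
    step {v} v∈R with inNeighbours T v (x ∷ xs) in eq | inNeighbours-< T v∈R
    ... | []     | _  = meets-weaken (m≤n+m _ _) (m (source-king T v∈R eq))
    ... | y ∷ ys | lt =
      -- The pivot is not its own in-neighbour, so each round removes a vertex and the bound on the
      -- number of rounds is never exceeded.
      meets-findKing f y ys (s≤s⁻¹ (≤-trans (s≤s⁻¹ lt) ∣xs∣≤f)) (≤-trans (<⇒≤ lt) ∣R∣≤n)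
        λ king → m (king-inNeighbours T (subst (λ S → KingOf T S _) (sym eq) king))

-- Deterministic pivots from a sample.

module Sampling {n A} (M : QueryModel n A) where
  open QueryModel M

  -- The last candidate is taken untested: when some candidate is balanced and all earlier ones
  -- fail, it must be the last.
  firstBalanced : List (Fin n) → Fin n → List (Fin n) → (Fin n → Alg) → Alg
  firstBalanced S x []       k = k x
  firstBalanced S x (y ∷ ys) k = askInNeighbours x S λ B →
    if does (2 * length B ≤? length S) then k x else firstBalanced S y ys k

  meets-firstBalanced : ∀ {T P c} S x xs {k} → Any (Balanced T S) (x ∷ xs) →
    (∀ {v} → v ∈ x ∷ xs → Balanced T S v → Meets T P c (k v)) →
    Meets T P (length xs * length S + c) (firstBalanced S x xs k)
  meets-firstBalanced S x [] (here b) m = m (here refl) b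
  meets-firstBalanced {T} {P} {c} S x (y ∷ ys) {k} any m =
    meets-weaken (≤-reflexive (sym (+-assoc (length S) (length ys * length S) c)))
      (meets-askInNeighbours x S
        {λ B → if does (2 * length B ≤? length S) then k x else firstBalanced S y ys k} (step any))
    where
    step : Any (Balanced T S) (x ∷ y ∷ ys) → Meets T P (length ys * length S + c)
             (if does (balanced? T S x) then k x else firstBalanced S y ys k)
    step any = meets-if (balanced? T S x) (λ b → meets-weaken (m≤n+m c _) (m (here refl) b))
                                          (λ ¬b → meets-firstBalanced S y ys (drop ¬b any) (m ∘ there))
      where
      drop : ¬ Balanced T S x → Any (Balanced T S) (x ∷ y ∷ ys) → Any (Balanced T S) (y ∷ ys)
      drop ¬b (here b)    = contradiction b ¬b
      drop ¬b (there any) = any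

private
  +-suc-mono : ∀ {a b c d} → a + b ≤ c + d → a + suc b ≤ c + suc d
  +-suc-mono {a} {b} {c} {d} le rewrite +-suc a b | +-suc c d = s≤s le

-- Each vertex of `R` beyond the sample adds at most one in-neighbour. The additive form avoids
-- truncated subtraction.
inNeighbours-take : ∀ (T : Tournament n) v k R →
  length (inNeighbours T v R) + length (take k R) ≤
  length (inNeighbours T v (take k R)) + length R
inNeighbours-take T v zero    R       =
  ≤-trans (≤-reflexive (+-identityʳ _)) (length-filter (λ u → _⟶?_ T u v) R)
inNeighbours-take T v (suc k) []      = z≤n
inNeighbours-take T v (suc k) (x ∷ R) with edge T x v
... | true  = s≤s (+-suc-mono (inNeighbours-take T v k R))
... | false = +-suc-mono (inNeighbours-take T v k R)

detQueryModel : ∀ n A → QueryModel n A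
detQueryModel n A = record
  { Alg           = DetAlg n A
  ; answer        = output
  ; compare       = query
  ; Meets         = λ T P c a → P (run T a) × queries T a ≤ c
  ; meets-answer  = λ p → p , z≤n
  ; meets-compare = λ _ (p , q) → p , s≤s q
  ; meets-weaken  = λ c≤d (p , q) → p , ≤-trans q c≤d
  }

-- With samples of size s = r + 1, a round costs at most s² + m queries on m ≤ s²
-- vertices and discards at least half of the sample.
samplingModel : ∀ {n A} r → n ≤ suc r * suc r → PivotModel n A
samplingModel {n} {A} r n≤s² = record
  { queryModel      = detQueryModel n A
  ; rate            = 4 * s
  ; withPivot       = λ x xs k → firstBalanced (x ∷ take r xs) x (take r xs) k
  ; meets-withPivot = λ {T} {P} {c} x xs {k} → meets {T} {P} {c} x xs {k}
  }
  where
  s = suc r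
  open QueryModel (detQueryModel n A)
  open Sampling (detQueryModel n A)

  -- Either the sample has `s` vertices and `n ≤ s * s` applies, or the sample is all of `R`.
  ≤s*∣sample∣ : ∀ (R : List (Fin n)) → length R ≤ n → length R ≤ s * length (take s R)
  ≤s*∣sample∣ R ∣R∣≤n rewrite length-take s R with ≤-total s (length R)
  ... | inj₁ s≤ rewrite m≤n⇒m⊓n≡m s≤ = ≤-trans ∣R∣≤n n≤s²
  ... | inj₂ ≤s rewrite m≥n⇒m⊓n≡n ≤s = m≤m+n _ _

  -- Here `i` and `j` are the in-degrees of the pivot in `R` and in the sample, and `m` and `t` are
  -- the sizes of these sets. The conclusion says that `m - i` is at least `t / 2`.
  discard : ∀ {i j m t} → i + t ≤ j + m → 2 * j ≤ t → 2 * i + t ≤ 2 * m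
  discard {i} {j} {m} {t} i+t≤j+m 2j≤t = +-cancelʳ-≤ t _ _ (begin
    2 * i + t + t ≡⟨ eq₁ i t ⟩
    2 * (i + t)   ≤⟨ *-monoʳ-≤ 2 i+t≤j+m ⟩
    2 * (j + m)   ≡⟨ eq₂ j m ⟩
    2 * m + 2 * j ≤⟨ +-monoʳ-≤ (2 * m) 2j≤t ⟩
    2 * m + t     ∎)
    where
    open ≤-Reasoning
    eq₁ : ∀ i t → 2 * i + t + t ≡ 2 * (i + t)
    eq₁ = solve-∀
    eq₂ : ∀ j m → 2 * (j + m) ≡ 2 * m + 2 * j
    eq₂ = solve-∀

  -- The tests on the sample and the final scan of `R` each cost at most `s * t`. Discarding at
  -- least `t / 2` vertices at rate `4 * s` releases `2 * s * t`, which pays for both.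
  budget : ∀ {m i p c} → let t = suc p in t ≤ s → m ≤ s * t → 2 * i + t ≤ 2 * m →
           p * t + (m + (4 * s * i + c)) ≤ 4 * s * m + c
  budget {m} {i} {p} {c} t≤s m≤st 2i+t≤2m = begin
    p * t + (m + (4 * s * i + c))
      ≤⟨ +-mono-≤ (*-monoˡ-≤ t (≤-trans (n≤1+n p) t≤s)) (+-monoˡ-≤ _ m≤st) ⟩
    s * t + (s * t + (4 * s * i + c)) ≡⟨ eq₁ s t i c ⟩
    2 * s * (2 * i + t) + c           ≤⟨ +-monoˡ-≤ c (*-monoʳ-≤ (2 * s) 2i+t≤2m) ⟩
    2 * s * (2 * m) + c               ≡⟨ eq₂ s m c ⟩
    4 * s * m + c                     ∎
    where
    open ≤-Reasoning
    t = suc p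
    eq₁ : ∀ s t i c → s * t + (s * t + (4 * s * i + c)) ≡ 2 * s * (2 * i + t) + c
    eq₁ = solve-∀
    eq₂ : ∀ s m c → 2 * s * (2 * m) + c ≡ 4 * s * m + c
    eq₂ = solve-∀

  meets : ∀ {T P c} x xs {k} → let R = x ∷ xs in length R ≤ n →
    (∀ {v} → v ∈ R → Meets T P (length R + (4 * s * length (inNeighbours T v R) + c)) (k v)) →
    Meets T P (4 * s * length R + c) (firstBalanced (x ∷ take r xs) x (take r xs) k)
  meets {T} {P} {c} x xs {k} ∣R∣≤n m =
    -- The continuation needs one bound for all pivots, so it gets the whole budget left after the
    -- tests. The instance `i = 0` shows that the tests fit the budget, so the subtraction does not
    -- truncate.
    meets-weaken {T} {P} {a = firstBalanced S x ys k}
      (≤-reflexive (m+[n∸m]≡n (m+n≤o⇒m≤o (length ys * length S) (affordable {0} 0-bound))))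
      (meets-firstBalanced {T} {P} S x ys {k} (any-balanced T x ys) λ {v} v∈S b →
        let i = length (inNeighbours T v R)
            j = length (inNeighbours T v S)
            half = discard {i} {j} {length R} (inNeighbours-take T v s R) b
        in meets-weaken {T} {P} {a = k v}
          (m+n≤o⇒m≤o∸n _ (≤-trans (≤-reflexive (+-comm _ (length ys * length S)))
            (affordable {i} half)))
          (m (∈-take v∈S)))
    where
    R = x ∷ xs
    ys = take r xs
    S = x ∷ ys
    ∣S∣≡ : length S ≡ s ⊓ length R
    ∣S∣≡ = length-take s R
    0-bound : length S ≤ 2 * length R
    0-bound = ≤-trans (≤-reflexive ∣S∣≡) (≤-trans (m⊓n≤n s _) (m≤m+n _ _))
    affordable : ∀ {i} → 2 * i + length S ≤ 2 * length R →
      length ys * length S + (length R + (4 * s * i + c)) ≤ 4 * s * length R + c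
    affordable = budget (≤-trans (≤-reflexive ∣S∣≡) (m⊓n≤m s _)) (≤s*∣sample∣ R ∣R∣≤n)
    ∈-take : ∀ {v} → v ∈ S → v ∈ R
    ∈-take = All.lookup (All.take⁺ s (All.tabulate λ v∈R → v∈R))

-- Expected costs and the uniformly random pivot.

fromℕ : ℕ → ℚ
fromℕ c = + c / 1

-- Passing to unnormalised fractions reduces the facts about `fromℕ` below to integer arithmetic,
-- free of common divisors.
toℚᵘ-fromℕ : ∀ c → ℚ.toℚᵘ (fromℕ c) ℚᵘ.≃ ℚᵘ.mkℚᵘ (+ c) 0
toℚᵘ-fromℕ c = ℚ.toℚᵘ-fromℚᵘ (ℚᵘ.mkℚᵘ (+ c) 0)

fromℕ-+ : ∀ c d → fromℕ (c + d) ≡ fromℕ c ℚ.+ fromℕ d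
fromℕ-+ c d = ℚ.toℚᵘ-injective (begin-equality
  ℚ.toℚᵘ (fromℕ (c + d))                      ≃⟨ toℚᵘ-fromℕ (c + d) ⟩
  ℚᵘ.mkℚᵘ (+ (c + d)) 0                       ≃⟨ ℚᵘ.*≡* (cong (ℤ._* + 1) eq) ⟩
  ℚᵘ.mkℚᵘ (+ c) 0 ℚᵘ.+ ℚᵘ.mkℚᵘ (+ d) 0        ≃⟨ ℚᵘ.+-cong (toℚᵘ-fromℕ c) (toℚᵘ-fromℕ d) ⟨
  ℚ.toℚᵘ (fromℕ c) ℚᵘ.+ ℚ.toℚᵘ (fromℕ d)      ≃⟨ ℚ.toℚᵘ-homo-+ (fromℕ c) (fromℕ d) ⟨
  ℚ.toℚᵘ (fromℕ c ℚ.+ fromℕ d)                ∎)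
  where
  open ℚᵘ.≤-Reasoning
  eq : + (c + d) ≡ + c ℤ.* + 1 ℤ.+ + d ℤ.* + 1
  eq = sym (cong₂ ℤ._+_ (ℤ.*-identityʳ (+ c)) (ℤ.*-identityʳ (+ d)))

fromℕ-mono-≤ : c ≤ d → fromℕ c ℚ.≤ fromℕ d
fromℕ-mono-≤ {c} {d} c≤d = ℚ.toℚᵘ-cancel-≤ (begin
  ℚ.toℚᵘ (fromℕ c) ≃⟨ toℚᵘ-fromℕ c ⟩
  ℚᵘ.mkℚᵘ (+ c) 0  ≤⟨ ℚᵘ.*≤* (ℤ.*-monoʳ-≤-nonNeg (+ 1) (ℤ.+≤+ c≤d)) ⟩
  ℚᵘ.mkℚᵘ (+ d) 0  ≃⟨ toℚᵘ-fromℕ d ⟨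
  ℚ.toℚᵘ (fromℕ d) ∎)
  where open ℚᵘ.≤-Reasoning

1/m*fromℕ : ∀ m .{{_ : NonZero m}} d → (+ 1 / m) ℚ.* fromℕ (m * d) ≡ fromℕ d
1/m*fromℕ m@(suc m-1) d = ℚ.toℚᵘ-injective (begin-equality
  ℚ.toℚᵘ ((+ 1 / m) ℚ.* fromℕ (m * d))            ≃⟨ ℚ.toℚᵘ-homo-* (+ 1 / m) (fromℕ (m * d)) ⟩
  ℚ.toℚᵘ (+ 1 / m) ℚᵘ.* ℚ.toℚᵘ (fromℕ (m * d))    ≃⟨ ℚᵘ.*-cong (ℚ.toℚᵘ-fromℚᵘ (ℚᵘ.mkℚᵘ (+ 1) m-1)) (toℚᵘ-fromℕ (m * d)) ⟩
  ℚᵘ.mkℚᵘ (+ 1) m-1 ℚᵘ.* ℚᵘ.mkℚᵘ (+ (m * d)) 0    ≃⟨ ℚᵘ.*≡* eq ⟩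
  ℚᵘ.mkℚᵘ (+ d) 0                                 ≃⟨ toℚᵘ-fromℕ d ⟨
  ℚ.toℚᵘ (fromℕ d)                                ∎)
  where
  open ℚᵘ.≤-Reasoning
  eq : (+ 1 ℤ.* + (m * d)) ℤ.* + 1 ≡ + d ℤ.* + (m * 1)
  eq = trans (ℤ.*-identityʳ _) (trans (ℤ.*-identityˡ _) (trans
         (cong +_ (trans (*-comm m d) (cong (d *_) (sym (*-identityʳ m)))))
         (ℤ.pos-* d (m * 1))))

open import Algebra.Properties.CommutativeMonoid.Sum ℚ.+-0-commutativeMonoid
  using () renaming (sum to ∑)

∑-lookup-≤ : ∀ {A : Set} (R : List A) (E : A → ℚ) (f : A → ℕ) →
  (∀ {v} → v ∈ R → E v ℚ.≤ fromℕ (f v)) → ∑ (λ i → E (lookup R i)) ℚ.≤ fromℕ (sum (map f R))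
∑-lookup-≤ []      E f le = ℚ.≤-refl
∑-lookup-≤ (x ∷ R) E f le = ℚ.≤-trans
  (ℚ.+-mono-≤ (le (here refl)) (∑-lookup-≤ R E f (le ∘ there)))
  (ℚ.≤-reflexive (sym (fromℕ-+ (f x) (sum (map f R)))))

mean-≤ : ∀ m .{{_ : NonZero m}} d {q} → q ℚ.≤ fromℕ (m * d) → (+ 1 / m) ℚ.* q ℚ.≤ fromℕ d
mean-≤ m d q≤ = ℚ.≤-trans
  (ℚ.*-monoˡ-≤-nonNeg (+ 1 / m) {{ℚ.normalize-nonNeg 1 m}} q≤)
  (ℚ.≤-reflexive (1/m*fromℕ m d))

-- Applied with `g` the in-degree within `R`, this isolates the sum of in-degrees in the total cost
-- over all pivots.
sum-map-affine : ∀ {A : Set} (g : A → ℕ) a c R →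
  sum (map (λ v → a + (2 * g v + c)) R) ≡ length R * (a + c) + 2 * sum (map g R)
sum-map-affine g a c []      = refl
sum-map-affine g a c (x ∷ R) rewrite sum-map-affine g a c R =
  regroup a c (g x) (length R * (a + c)) (sum (map g R))
  where
  regroup : ∀ a c g l s → (a + (2 * g + c)) + (l + 2 * s) ≡ ((a + c) + l) + 2 * (g + s)
  regroup = solve-∀

randQueryModel : ∀ n A → QueryModel n A
randQueryModel n A = record
  { Alg           = RandAlg n A
  ; answer        = output
  ; compare       = query
  ; Meets         = λ T P c a → Always T P a × expectedQueries T a ℚ.≤ fromℕ c
  ; meets-answer  = λ {c = c} p → p , fromℕ-mono-≤ {0} {c} z≤n
  ; meets-compare = λ {c = c} _ (p , q) → p , ℚ.≤-trans (ℚ.+-monoʳ-≤ 1ℚ q)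
                                                (ℚ.≤-reflexive (sym (fromℕ-+ 1 c)))
  ; meets-weaken  = λ {c = c} {d} c≤d (p , q) → p , ℚ.≤-trans q (fromℕ-mono-≤ {c} {d} c≤d)
  }

-- The in-degrees within R of the vertices of R average to at most |R| / 2.
randomPivotModel : ∀ n A → PivotModel n A
randomPivotModel n A = record
  { queryModel      = randQueryModel n A
  ; rate            = 2
  ; withPivot       = λ x xs k → random (suc (length xs)) (λ i → k (lookup (x ∷ xs) i))
  ; meets-withPivot = λ {T} {P} {c} x xs {k} _ → meets {T} {P} {c} x xs {k}
  }
  where
  open QueryModel (randQueryModel n A)

  meets : ∀ {T P c} x xs {k} → let R = x ∷ xs in
    (∀ {v} → v ∈ R → Meets T P (length R + (2 * length (inNeighbours T v R) + c)) (k v)) →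
    Meets T P (2 * length R + c) (random (suc (length xs)) (λ i → k (lookup R i)))
  meets {T} {P} {c} x xs {k} m =
    (λ i → proj₁ (m (∈-lookup i))) ,
    mean-≤ (length R) (2 * length R + c) (ℚ.≤-trans
      (∑-lookup-≤ R (λ v → expectedQueries T (k v)) cost (λ v∈R → proj₂ (m v∈R)))
      (fromℕ-mono-≤ {sum (map cost R)} {length R * (2 * length R + c)} total))
    where
    R = x ∷ xs
    open ≤-Reasoning
    regroup : ∀ m c → m * (m + c) + m * m ≡ m * (2 * m + c)
    regroup = solve-∀
    cost : Fin n → ℕ
    cost v = length R + (2 * length (inNeighbours T v R) + c)
    total : sum (map cost R) ≤ length R * (2 * length R + c)
    total = begin
      sum (map cost R)
        ≡⟨ sum-map-affine (λ v → length (inNeighbours T v R)) (length R) c R ⟩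
      length R * (length R + c) + 2 * inDegrees T R R
        -- This fixes the rate at 2: with `m` vertices, the scan costs `m` and the potential left
        -- over is at most `m` on average.
        ≤⟨ +-monoʳ-≤ (length R * (length R + c)) (2*inDegrees≤length² T R) ⟩
      length R * (length R + c) + length R * length R
        ≡⟨ regroup (length R) c ⟩
      length R * (2 * length R + c) ∎

-- Sets of kings and the chain of two or three kings.

∣⁅x⁆∪p∣ : ∀ {x : Fin n} {p} → x ∉ p → ∣ ⁅ x ⁆ ∪ p ∣ ≡ suc ∣ p ∣
∣⁅x⁆∪p∣ {x = zero}  {true ∷ p}  x∉p = contradiction here x∉p
∣⁅x⁆∪p∣ {x = zero}  {false ∷ p} x∉p = cong (suc ∘ ∣_∣) (∪-identityˡ p)
∣⁅x⁆∪p∣ {x = suc x} {true ∷ p}  x∉p = cong suc (∣⁅x⁆∪p∣ (x∉p ∘ there))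
∣⁅x⁆∪p∣ {x = suc x} {false ∷ p} x∉p = ∣⁅x⁆∪p∣ (x∉p ∘ there)

isKingSet-⁅⁆ : ∀ (T : Tournament n) {v} → IsKing T v → IsKingSet T 1 ⁅ v ⁆
isKingSet-⁅⁆ T {v} king =
  ∣⁅x⁆∣≡1 v , λ u∈ → subst (IsKing T) (sym (x∈⁅y⁆⇒x≡y v u∈)) king

isKingSet-∪ : ∀ (T : Tournament n) {k v S} → IsKing T v → v ∉ S → IsKingSet T k S →
              IsKingSet T (suc k) (⁅ v ⁆ ∪ S)
isKingSet-∪ T {k} {v} {S} king v∉S (∣S∣≡k , kings) =
  trans (∣⁅x⁆∪p∣ v∉S) (cong suc ∣S∣≡k) , λ u∈ → kings′ (x∈p∪q⁻ ⁅ v ⁆ S u∈)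
  where
  kings′ : ∀ {u} → u ∈ₛ ⁅ v ⁆ ⊎ u ∈ₛ S → IsKing T u
  kings′ (inj₁ u∈) = subst (IsKing T) (sym (x∈⁅y⁆⇒x≡y v u∈)) king
  kings′ (inj₂ u∈) = kings u∈

module KingChain {m : ℕ} (M : PivotModel (suc m) (Maybe (Subset (suc m)))) where
  open PivotModel M

  N = suc m
  V = allFin N

  ∣V∣≡N : length V ≡ N
  ∣V∣≡N = length-tabulate {n = N} (λ v → v)

  findFirstKing : (Fin N → Alg) → Alg
  findFirstKing = findKing m zero (tabulate suc)

  findKingIn : List (Fin N) → (Fin N → Alg) → Alg
  findKingIn []       k = answer nothing
  findKingIn (y ∷ ys) k = findKing m y ys k

  findKingBeating : Fin N → (Fin N → Alg) → Alg
  findKingBeating v k = askInNeighbours v V λ S → findKingIn S k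

  kings₂ kings₃ : Alg
  kings₂ = findFirstKing λ v₁ → findKingBeating v₁ λ v₂ → answer (just (⁅ v₁ ⁆ ∪ ⁅ v₂ ⁆))
  kings₃ = findFirstKing λ v₁ → findKingBeating v₁ λ v₂ → findKingBeating v₂ λ v₃ →
    answer (just (⁅ v₁ ⁆ ∪ (⁅ v₂ ⁆ ∪ ⁅ v₃ ⁆)))

  module _ {T : Tournament N} where
    open Tournament T using (_⟶_)

    meets-findFirstKing : ∀ {P c k} → (∀ {v} → IsKing T v → Meets T P c (k v)) →
                          Meets T P (rate * N + c) (findFirstKing k)
    meets-findFirstKing {P} {c} {k} h =
      subst (λ l → Meets T P (rate * l + c) (findFirstKing k)) ∣V∣≡N
        (meets-findKing m zero (tabulate suc) (≤-reflexive (length-tabulate {n = m} suc)) (≤-reflexive ∣V∣≡N)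
          (h ∘ KingOf-allFin T))

    meets-findKingBeating : ∀ {P c v k} → (inNeighbours T v V ≡ [] → P nothing) →
      (∀ {w} → IsKing T w → w ⟶ v → Meets T P c (k w)) →
      Meets T P (N + (rate * N + c)) (findKingBeating v k)
    meets-findKingBeating {P} {c} {v} {k} none h =
      subst (λ l → Meets T P (l + (rate * N + c)) (findKingBeating v k)) ∣V∣≡N
        (meets-askInNeighbours v V {λ S → findKingIn S k} (next _ refl))
      where
      next : ∀ S → inNeighbours T v V ≡ S →
             Meets T P (rate * N + c) (findKingIn S k)
      next []       eq = meets-answer (none eq)
      next (y ∷ ys) eq = meets-weaken (+-monoˡ-≤ c (*-monoʳ-≤ rate ∣S∣≤N))
        (meets-findKing _ y ys (s≤s⁻¹ ∣S∣≤N) ∣S∣≤N λ { king@(w∈S , _) →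
          h (KingOf-allFin T (king-inNeighbours T (subst (λ S → KingOf T S _) (sym eq) king)))
            (proj₂ (∈-filter⁻ (λ u → _⟶?_ T u v) {xs = V} (subst (_ ∈_) (sym eq) w∈S))) })
        where
        ∣S∣≤N : length (y ∷ ys) ≤ N
        ∣S∣≤N = subst₂ _≤_ (cong length eq) ∣V∣≡N (length-filter (λ u → _⟶?_ T u v) V)

    meets-kings₂ : Meets T (SolvesKKing T 2) (3 * (rate * N) + 2 * N) kings₂
    -- The slack `rate * N + N` is the cost of a third king, so that two and three kings share one
    -- bound.
    meets-kings₂ = meets-weaken (≤-trans (m≤m+n _ (rate * N + N)) (≤-reflexive (regroup (rate * N) N)))
      (meets-findFirstKing λ {v₁} king₁ → meets-findKingBeating
        (λ none (S , kings) → contradiction (source⇒∣kings∣≤1 T none S kings) λ { (s≤s ()) })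
        λ {v₂} king₂ v₂⟶v₁ → meets-answer {c = 0}
          (isKingSet-∪ T king₁ (λ v₁∈ → ⟶-irrefl T (subst (v₂ ⟶_) (x∈⁅y⁆⇒x≡y v₂ v₁∈) v₂⟶v₁))
            (isKingSet-⁅⁆ T king₂)))
      where
      regroup : ∀ a N → a + (N + (a + 0)) + (a + N) ≡ 3 * a + 2 * N
      regroup = solve-∀

    meets-kings₃ : Meets T (SolvesKKing T 3) (3 * (rate * N) + 2 * N) kings₃
    meets-kings₃ = meets-weaken (≤-reflexive (regroup (rate * N) N))
      (meets-findFirstKing λ {v₁} king₁ → meets-findKingBeating
        (λ none (S , kings) → contradiction (source⇒∣kings∣≤1 T none S kings) λ { (s≤s ()) })
        λ {v₂} king₂ v₂⟶v₁ → meets-findKingBeating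
          -- If `v₂` had no in-neighbours, it would be the only king and equal `v₁`, making
          -- `v₂ ⟶ v₁` a loop.
          (λ none → contradiction
            (subst (v₂ ⟶_) (source-unique-king T none king₁) v₂⟶v₁) (⟶-irrefl T))
          λ {v₃} king₃ v₃⟶v₂ → meets-answer {c = 0}
            (isKingSet-∪ T king₁ (v₁∉ v₂⟶v₁ v₃⟶v₂)
              (isKingSet-∪ T king₂ (λ v₂∈ → ⟶-irrefl T (subst (v₃ ⟶_) (x∈⁅y⁆⇒x≡y v₃ v₂∈) v₃⟶v₂))
                (isKingSet-⁅⁆ T king₃))))
      where
      v₁∉ : ∀ {v₁ v₂ v₃} → v₂ ⟶ v₁ → v₃ ⟶ v₂ → v₁ ∉ ⁅ v₂ ⁆ ∪ ⁅ v₃ ⁆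
      v₁∉ {v₁} {v₂} {v₃} v₂⟶v₁ v₃⟶v₂ v₁∈ with x∈p∪q⁻ ⁅ v₂ ⁆ ⁅ v₃ ⁆ v₁∈
      ... | inj₁ v₁∈₂ = ⟶-irrefl T (subst (v₂ ⟶_) (x∈⁅y⁆⇒x≡y v₂ v₁∈₂) v₂⟶v₁)
      ... | inj₂ v₁∈₃ = ⟶-asym T v₃⟶v₂ (subst (v₂ ⟶_) (x∈⁅y⁆⇒x≡y v₃ v₁∈₃) v₂⟶v₁)
      regroup : ∀ a N → a + (N + (a + (N + (a + 0)))) ≡ 3 * a + 2 * N
      regroup = solve-∀

module _ (M : ∀ n → PivotModel n (Maybe (Subset n))) where
  open module Model {n} = PivotModel (M n) using (Alg; Meets; rate; answer; meets-answer)

  kings : ∀ {k} → (k ≡ 2) ⊎ (k ≡ 3) → ∀ n → Alg {n}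
  kings _        zero    = answer nothing
  kings (inj₁ _) (suc m) = KingChain.kings₂ (M (suc m))
  kings (inj₂ _) (suc m) = KingChain.kings₃ (M (suc m))

  meets-kings : ∀ {k} (k≡ : (k ≡ 2) ⊎ (k ≡ 3)) n (T : Tournament n) →
    Meets T (SolvesKKing T k) (3 * (rate {n} * n) + 2 * n) (kings k≡ n)
  -- Without vertices the only subset has size 0.
  meets-kings (inj₁ refl) zero    T = meets-answer λ { ([] , () , _) }
  meets-kings (inj₂ refl) zero    T = meets-answer λ { ([] , () , _) }
  meets-kings (inj₁ refl) (suc m) T = KingChain.meets-kings₂ (M (suc m))
  meets-kings (inj₂ refl) (suc m) T = KingChain.meets-kings₃ (M (suc m))

-- Integer square roots and the final bounds.

-- The sample size is `suc r`: the first bound limits the cost, the second is what sampling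
-- requires. As neither is strict, `r` may be one less than the integer square root.
isqrt : ∀ n → ∃[ r ] r * r ≤ n × n ≤ suc r * suc r
isqrt zero = 0 , z≤n , z≤n
isqrt (suc n) with isqrt n
... | r , r²≤n , n≤s² with suc n ≤? suc r * suc r
...   | yes n<s² = r , m≤n⇒m≤1+n r²≤n , n<s²
...   | no n≮s²  = suc r , ≤-trans (s≤s⁻¹ (≰⇒> n≮s²)) (n≤1+n n) ,
                   ≤-trans (s≤s n≤s²) (*-mono-< (n<1+n (suc r)) (n<1+n (suc r)))

-- Adding `2 * r * n` rounds the cost up to `14 * suc r * n`. The square of `suc r` is at most
-- `3 * n + 1`, and `n * n` is at most the cube of `n`, so the squared cost is at most `196 * 4`
-- times that cube, whence 28.
three-halves : ∀ n r {q} → r * r ≤ n → q ≤ 3 * (4 * suc r * n) + 2 * n → q ≤ 28 · n ^3/2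
three-halves n r {q} r²≤n q≤ = begin
  q ^ 2                                   ≤⟨ ^-monoˡ-≤ 2 q≤ ⟩
  (3 * (4 * suc r * n) + 2 * n) ^ 2       ≤⟨ ^-monoˡ-≤ 2 (m≤m+n (3 * (4 * suc r * n) + 2 * n) (2 * r * n)) ⟩
  (3 * (4 * suc r * n) + 2 * n + 2 * r * n) ^ 2 ≡⟨ eq₁ r n ⟩
  196 * ((r * r + 2 * r + 1) * (n * n))
    ≤⟨ *-monoʳ-≤ 196 (*-monoˡ-≤ (n * n) (+-monoˡ-≤ 1 (+-monoʳ-≤ (r * r) (*-monoʳ-≤ 2 (m≤m*m r))))) ⟩
  196 * ((r * r + 2 * (r * r) + 1) * (n * n))
    ≤⟨ *-monoʳ-≤ 196 (*-monoˡ-≤ (n * n) (+-monoˡ-≤ 1 (+-mono-≤ r²≤n (*-monoʳ-≤ 2 r²≤n)))) ⟩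
  196 * ((n + 2 * n + 1) * (n * n))       ≡⟨ eq₂ n ⟩
  588 * (n * (n * n)) + 196 * (n * n)
    ≤⟨ +-monoʳ-≤ (588 * (n * (n * n))) (*-monoʳ-≤ 196 (*-monoʳ-≤ n (m≤m*m n))) ⟩
  588 * (n * (n * n)) + 196 * (n * (n * n)) ≡⟨ eq₃ n ⟩
  28 ^ 2 * n ^ 3                          ∎
  where
  open ≤-Reasoning
  m≤m*m : ∀ m → m ≤ m * m
  m≤m*m zero    = z≤n
  m≤m*m (suc m) = m≤m*n (suc m) (suc m)
  eq₁ : ∀ r n → (3 * (4 * suc r * n) + 2 * n + 2 * r * n) * ((3 * (4 * suc r * n) + 2 * n + 2 * r * n) * 1)
                ≡ 196 * ((r * r + 2 * r + 1) * (n * n))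
  eq₁ = solve-∀
  eq₂ : ∀ n → 196 * ((n + 2 * n + 1) * (n * n)) ≡ 588 * (n * (n * n)) + 196 * (n * n)
  eq₂ = solve-∀
  eq₃ : ∀ n → 588 * (n * (n * n)) + 196 * (n * (n * n)) ≡ 784 * (n * (n * (n * 1)))
  eq₃ = solve-∀

theorem1p3 : ∀ (k : ℕ) → (k ≡ 2) ⊎ (k ≡ 3) → KKingRandomizedLinear k × KKingDeterministicThreeHalves k
theorem1p3 k k≡ = randomized , deterministic
  where
  randomized : KKingRandomizedLinear k
  randomized = kings randomPivot k≡ , 8 , λ n T →
    subst (λ c → QueryModel.Meets (randQueryModel n _) T (SolvesKKing T k) c (kings randomPivot k≡ n))
      (eq n) (meets-kings randomPivot k≡ n T)
    where
    randomPivot = λ n → randomPivotModel n (Maybe (Subset n))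
    eq : ∀ n → 3 * (2 * n) + 2 * n ≡ 8 * n
    eq = solve-∀

  deterministic : KKingDeterministicThreeHalves k
  deterministic = kings sampling k≡ , 28 , λ n T →
    let r , r²≤n , _ = isqrt n
        solved , cost = meets-kings sampling k≡ n T
    in solved , three-halves n r r²≤n cost
    where
    sampling = λ n → let r , _ , n≤s² = isqrt n in samplingModel {n} {Maybe (Subset n)} r n≤s²
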